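{- Let $\lambda$ be a nonzero real number and $n$ a positive integer. Then $$(n-1)!\,H_{n,-\lambda}=\sum_{k=1}^{n}(-1)^{n-k}\beta_{k-1,\lambda}(1-\lambda)\,S_{1,-\lambda}(n,k).$$
   Context: For a nonzero real parameter $\mu$ (used here with $\mu=\lambda$ and $\mu=-\lambda$), real $y$ and integer $k\ge0$: $(y)_{0,\mu}=1$, $(y)_{k,\mu}=y(y-\mu)\cdots(y-(k-1)\mu)$; $(y)_0=1$, $(y)_k=y(y-1)\cdots(y-k+1)$. The degenerate exponential is $e_\mu^x(t)=\sum_{k\ge0}(x)_{k,\mu}t^k/k!=(1+\mu t)^{x/\mu}$, $e_\mu(t)=e^1_\mu(t)$. The degenerate Bernoulli polynomials are defined by $\frac{t}{e_\mu(t)-1}e_\mu^x(t)=\sum_{n\ge0}\beta_{n,\mu}(x)\frac{t^n}{n!}$. The degenerate Stirling numbers of the first kind $S_{1,\mu}(n,k)$ are defined by $(x)_{n}=\sum_{k=0}^{n}S_{1,\mu}(n,k)(x)_{k,\mu}$ ($n\ge0$). The degenerate harmonic numbers are $H_{0,\mu}=0$ and $H_{n,\mu}=\sum_{k=1}^{n}\frac{1}{\mu}\binom{\mu}{k}(-1)^{k-1}$ for $n\ge1$. -}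

module Defs where

open import Level using (_⊔_) renaming (suc to lsuc)
open import Algebra.Apartness.Bundles using (HeytingField; HeytingCommutativeRing)
open import Algebra.Bundles using (CommutativeRing)
import Algebra.Apartness.Properties.HeytingCommutativeRing as HeytingProperties
import Algebra.Definitions.RawMonoid as RawMonoidDefinitions
import Algebra.Properties.Semiring.Exp as SemiringExp
import Algebra.Properties.Monoid.Sum as MonoidSum
import Algebra.Properties.Ring as RingProperties
open import Data.Fin.Base using (toℕ)
open import Data.Nat.Base using (ℕ; zero; suc; _∸_; _≥_; _!; NonZero)
open import Data.Nat.Properties using (_!≢0)
open import Data.Product.Base using (∃-syntax; _×_; _,_; proj₁)
open import Data.Sum.Base using (_⊎_; inj₁; inj₂)
open import Relation.Binary.Core using (Rel)
open import Relation.Binary.Structures using (IsStrictPartialOrder)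

-- The real numbers, axiomatised as a Cauchy-complete Archimedean ordered
-- field.  Classically these axioms determine ℝ up to unique isomorphism; they
-- are phrased with apartness so that the constructive Cauchy reals satisfy
-- them as well.
record RealField c ℓ₁ ℓ₂ : Set (lsuc (c ⊔ ℓ₁ ⊔ ℓ₂)) where
  infix 4 _<_
  field
    heytingField : HeytingField c ℓ₁ ℓ₂

  open HeytingField heytingField public

  field
    _<_                  : Rel Carrier ℓ₂
    isStrictPartialOrder : IsStrictPartialOrder _≈_ _<_
    #⇒<⊎>                : ∀ {x y} → x # y → x < y ⊎ y < x
    <⇒#                  : ∀ {x y} → x < y → x # y
    +-monoʳ-<            : ∀ {x y} z → x < y → z + x < z + y
    *-pos                : ∀ {x y} → 0# < x → 0# < y → 0# < x * y

  commutativeRing : CommutativeRing c ℓ₁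
  commutativeRing = HeytingCommutativeRing.commutativeRing heytingCommutativeRing

  open CommutativeRing commutativeRing public
    using (ring; +-monoid; +-rawMonoid; semiring)

  fromℕ : ℕ → Carrier
  fromℕ n = RawMonoidDefinitions._×_ +-rawMonoid n 1#

  -- ∣ x - y ∣ < ε
  Within : Carrier → Carrier → Carrier → Set ℓ₂
  Within ε x y = (x - y < ε) × (y - x < ε)

  field
    archimedean : ∀ x → ∃[ n ] x < fromℕ n
    complete    : (s : ℕ → Carrier) →
                  (∀ ε → 0# < ε → ∃[ N ] (∀ m n → m ≥ N → n ≥ N → Within ε (s m) (s n))) →
                  ∃[ x ] (∀ ε → 0# < ε → ∃[ N ] (∀ n → n ≥ N → Within ε (s n) x))

module Degenerate {c ℓ₁ ℓ₂} (ℝ : RealField c ℓ₁ ℓ₂) where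

  open RealField ℝ public
  open HeytingProperties heytingCommutativeRing using (1#0; x-0≈x; invertibleˡ⇒#)
  open RingProperties ring using (-‿distribˡ-*; -‿distribʳ-*; -‿involutive)
  open IsStrictPartialOrder isStrictPartialOrder
    using (<-respˡ-≈; <-respʳ-≈) renaming (trans to <-trans)
  open MonoidSum +-monoid public using (sum; sum-syntax; sum⁺-syntax)
  open SemiringExp semiring public using (_^_)

  0<1 : 0# < 1#
  0<1 with #⇒<⊎> 1#0
  ... | inj₂ 0<1 = 0<1
  ... | inj₁ 1<0 = <-respʳ-≈ [-1]²≈1 (*-pos 0<-1 0<-1)
    where
    0<-1 : 0# < - 1#
    0<-1 = <-respˡ-≈ (-‿inverseˡ 1#) (<-respʳ-≈ (+-identityʳ (- 1#)) (+-monoʳ-< (- 1#) 1<0))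

    [-1]²≈1 : - 1# * - 1# ≈ 1#
    [-1]²≈1 = trans (sym (-‿distribˡ-* 1# (- 1#)))
                    (trans (-‿cong (*-identityˡ (- 1#))) (-‿involutive 1#))

  0<fromℕ[1+n] : ∀ n → 0# < fromℕ (suc n)
  0<fromℕ[1+n] zero    = <-respʳ-≈ (sym (+-identityʳ 1#)) 0<1
  0<fromℕ[1+n] (suc n) =
    <-trans 0<1 (<-respˡ-≈ (+-identityʳ 1#) (+-monoʳ-< 1# (0<fromℕ[1+n] n)))

  fromℕ#0 : ∀ n .{{_ : NonZero n}} → fromℕ n # 0#
  fromℕ#0 (suc n) = #-sym (<⇒# (0<fromℕ[1+n] n))

  n!#0 : ∀ n → fromℕ (n !) # 0#
  n!#0 n = fromℕ#0 (n !) {{n !≢0}}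

  -x#0 : ∀ {x} → x # 0# → - x # 0#
  -x#0 {x} x#0 with #⇒invertible x#0
  ... | y , y*[x-0]≈1 , _ = invertibleˡ⇒# (- y , proof)
    where
    proof : - y * (- x - 0#) ≈ 1#
    proof = trans (*-congˡ (x-0≈x (- x)))
           (trans (sym (-‿distribˡ-* y (- x)))
           (trans (-‿cong (sym (-‿distribʳ-* y x)))
           (trans (-‿involutive (y * x))
           (trans (*-congˡ (sym (x-0≈x x))) y*[x-0]≈1))))

  infix 9 _⁻¹

  -- The reciprocal of x, as a function of the proof that x is apart from 0.
  -- The library's witness inverts x - 0#, which equals x.
  _⁻¹ : ∀ {x} → x # 0# → Carrier
  x#0 ⁻¹ = proj₁ (#⇒invertible x#0)

  -- ∑[ k ∈1⋯ n ] f k  is  f 1 + ⋯ + f n.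
  sum₁-syntax : ∀ n → (ℕ → Carrier) → Carrier
  sum₁-syntax n f = ∑[ i < n ] f (suc (toℕ i))

  infixl 10 sum₁-syntax
  syntax sum₁-syntax n (λ k → x) = ∑[ k ∈1⋯ n ] x

  -- ∑[ k ∈0⋯ n ] f k  is  f 0 + ⋯ + f n.
  sum₀-syntax : ∀ n → (ℕ → Carrier) → Carrier
  sum₀-syntax n f = ∑[ i ≤ n ] f (toℕ i)

  infixl 10 sum₀-syntax
  syntax sum₀-syntax n (λ k → x) = ∑[ k ∈0⋯ n ] x

  -- (y)_{k,μ} = y (y - μ) ⋯ (y - (k-1) μ)
  degFalling : (μ y : Carrier) → ℕ → Carrier
  degFalling μ y zero    = 1#
  degFalling μ y (suc k) = degFalling μ y k * (y - fromℕ k * μ)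

  -- (y)_k = y (y - 1) ⋯ (y - k + 1)
  falling : (y : Carrier) → ℕ → Carrier
  falling y zero    = 1#
  falling y (suc k) = falling y k * (y - fromℕ k)

  binomial : (y : Carrier) → ℕ → Carrier
  binomial y k = falling y k * n!#0 k ⁻¹

  -- Formal power series in t, as coefficient sequences.
  Series : Set c
  Series = ℕ → Carrier

  infix  4 _≋_
  infixl 6 _⊖_
  infixl 7 _⊛_

  _≋_ : Series → Series → Set ℓ₁
  f ≋ g = ∀ n → f n ≈ g n

  _⊖_ : Series → Series → Series
  (f ⊖ g) n = f n - g n

  _⊛_ : Series → Series → Series
  (f ⊛ g) n = ∑[ i ∈0⋯ n ] (f i * g (n ∸ i))

  𝟙 : Series
  𝟙 zero    = 1#
  𝟙 (suc n) = 0#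

  𝕥 : Series
  𝕥 zero          = 0#
  𝕥 (suc zero)    = 1#
  𝕥 (suc (suc n)) = 0#

  -- ∑ₙ aₙ tⁿ / n!
  egf : (ℕ → Carrier) → Series
  egf a n = a n * n!#0 n ⁻¹

  -- e_μ^x(t)
  degExp : (μ x : Carrier) → Series
  degExp μ x = egf (degFalling μ x)

  -- β n x = β_{n,μ}(x), i.e. t / (e_μ(t) - 1) · e_μ^x(t) = ∑ₙ β_{n,μ}(x) tⁿ / n!,
  -- with the denominator cleared.  As e_μ(t) - 1 = t + ⋯, this determines β.
  IsDegenerateBernoulli : (μ : Carrier) → (ℕ → Carrier → Carrier) → Set (c ⊔ ℓ₁)
  IsDegenerateBernoulli μ β =
    ∀ x → (degExp μ 1# ⊖ 𝟙) ⊛ egf (λ n → β n x) ≋ 𝕥 ⊛ degExp μ x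

  -- S₁ n k = S_{1,μ}(n,k); only the values with k ≤ n are constrained.
  IsDegenerateStirling₁ : (μ : Carrier) → (ℕ → ℕ → Carrier) → Set (c ⊔ ℓ₁)
  IsDegenerateStirling₁ μ S₁ =
    ∀ n x → falling x n ≈ ∑[ k ∈0⋯ n ] (S₁ n k * degFalling μ x k)

  -- H_{n,μ}
  degHarmonic : {μ : Carrier} → μ # 0# → ℕ → Carrier
  degHarmonic {μ} μ#0 n =
    ∑[ k ∈1⋯ n ] (μ#0 ⁻¹ * binomial μ k * (- 1#) ^ (k ∸ 1))

{-# OPTIONS --safe #-}
module Submission where

-- Write n = m + 1, and expand y (y+1) ⋯ (y+m) = ∑ aₖ (y)_{k,λ}, where by the substitution
-- x = -y in the definition of the Stirling numbers aₖ = (-1)^{n-k} S_{1,-λ}(n,k).  Dividing by y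
-- and replacing y by y + λ gives  q(y) = (y+λ+1) ⋯ (y+λ+m) = ∑ aₖ₊₁ (y)_{k,λ},  so the right-hand
-- side of the theorem is Λ q for the linear functional Λ : (y)_{k,λ} ↦ β_{k,λ}(1-λ).  The defining
-- equation of β says  Λ (p(y+1) - p(y)) = (p(1) - p(1-λ)) / λ  for every polynomial p.  As
-- n q(y) = p(y+1) - p(y) for p(y) = (y+λ) (y+λ+1) ⋯ (y+λ+m),  it follows that
-- n λ Λ q = (1+λ) ⋯ (n+λ) - n!,  which equals n! λ H_{n,-λ} by induction on n.
--
-- To evaluate Λ on a polynomial identity, identities are tested at y = jλ (j ∈ ℕ): a linear form
-- in finitely many coefficients of a series is determined by its values on e_λ^{jλ}(t) = (1+λt)^j.

open import Defs
open import Data.Nat.Base using (ℕ; _∸_; _!; NonZero)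

open import Algebra.Bundles using (CommutativeRing)
import Algebra.Apartness.Properties.HeytingCommutativeRing as HeytingProperties
import Algebra.Properties.CommutativeMonoid.Sum as CommutativeMonoidSum
import Algebra.Properties.Group as GroupProperties
import Algebra.Properties.Ring as RingProperties
import Algebra.Properties.Semiring.Mult as SemiringMult
import Algebra.Properties.Semiring.Sum as SemiringSum
import Algebra.Solver.Ring.NaturalCoefficients.Default as SemiringSolver
open import Data.Fin.Base using (Fin; toℕ) renaming (zero to fzero; suc to fsuc)
open import Data.Fin.Properties using (toℕ<n)
open import Data.Nat.Base using (zero; suc; _≤_; _<_; z≤n; s≤s)
open import Data.Nat.Properties using (m∸n≤m; ≤-<-trans; m<n⇒m<1+n)
open import Data.Product.Base using (proj₁; proj₂)
open import Level using (_⊔_)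
import Relation.Binary.Reasoning.Setoid as SetoidReasoning

module _ {c ℓ₁ ℓ₂} (ℝ : RealField c ℓ₁ ℓ₂) where

  open Degenerate ℝ hiding (_<_; zero)
  open CommutativeRing commutativeRing
    using (commutativeSemiring; +-commutativeMonoid; +-group)
  open HeytingProperties heytingCommutativeRing using (x-0≈x)
  open CommutativeMonoidSum +-commutativeMonoid using (sum-cong-≋; sum-replicate-zero; ∑-distrib-+)
  open SemiringSum semiring using (*-distribˡ-sum)
  open SemiringMult semiring using (×1-homo-*)
  open RingProperties ring using (-1*x≈-x; -‿involutive)
  open GroupProperties +-group using (∙-cancelʳ; //-rightDividesˡ)
  open SemiringSolver commutativeSemiring using (solve; _:+_; _:*_; _:=_)
  open SetoidReasoning setoid

  -- Inverses and factorials

  ⁻¹-inverseˡ : ∀ {x} (x#0 : x # 0#) → x#0 ⁻¹ * x ≈ 1#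
  ⁻¹-inverseˡ {x} x#0 = trans (*-congˡ (sym (x-0≈x x))) (proj₁ (proj₂ (#⇒invertible x#0)))

  *-cancelˡ-# : ∀ {x} → x # 0# → ∀ {y z} → x * y ≈ x * z → y ≈ z
  *-cancelˡ-# {x} x#0 {y} {z} xy≈xz = trans (sym (undo y)) (trans (*-congˡ xy≈xz) (undo z))
    where
    undo : ∀ u → x#0 ⁻¹ * (x * u) ≈ u
    undo u = trans (sym (*-assoc _ _ _)) (trans (*-congʳ (⁻¹-inverseˡ x#0)) (*-identityˡ u))

  fromℕ-suc! : ∀ k → fromℕ (suc k !) ≈ fromℕ (suc k) * fromℕ (k !)
  fromℕ-suc! k = ×1-homo-* (suc k) (k !)

  !⁻¹-suc : ∀ k → n!#0 k ⁻¹ ≈ fromℕ (suc k) * n!#0 (suc k) ⁻¹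
  !⁻¹-suc k = *-cancelˡ-# (n!#0 k) (begin
    fromℕ (k !) * n!#0 k ⁻¹                          ≈⟨ *-comm _ _ ⟩
    n!#0 k ⁻¹ * fromℕ (k !)                          ≈⟨ ⁻¹-inverseˡ (n!#0 k) ⟩
    1#                                               ≈⟨ ⁻¹-inverseˡ (n!#0 (suc k)) ⟨
    n!#0 (suc k) ⁻¹ * fromℕ (suc k !)                ≈⟨ *-congˡ (fromℕ-suc! k) ⟩
    n!#0 (suc k) ⁻¹ * (fromℕ (suc k) * fromℕ (k !))
      ≈⟨ solve 3 (λ i s f → i :* (s :* f) := f :* (s :* i)) refl _ _ _ ⟩
    fromℕ (k !) * (fromℕ (suc k) * n!#0 (suc k) ⁻¹)  ∎)

  !*egf : ∀ a k → fromℕ (k !) * egf a k ≈ a k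
  !*egf a k = begin
    fromℕ (k !) * (a k * n!#0 k ⁻¹)  ≈⟨ solve 3 (λ f a i → f :* (a :* i) := a :* (i :* f)) refl _ _ _ ⟩
    a k * (n!#0 k ⁻¹ * fromℕ (k !))  ≈⟨ *-congˡ (⁻¹-inverseˡ (n!#0 k)) ⟩
    a k * 1#                         ≈⟨ *-identityʳ _ ⟩
    a k                              ∎

  -- Finite pairings of a coefficient vector with a series

  dot : ℕ → Series → Series → Carrier
  dot n a w = ∑[ i < n ] (a (toℕ i) * w (toℕ i))

  dot-cong : ∀ n a u b v → (∀ k → k < n → a k * u k ≈ b k * v k) → dot n a u ≈ dot n b v
  dot-cong n a u b v au≈bv = sum-cong-≋ {n} (λ i → au≈bv (toℕ i) (toℕ<n i))

  dot-zero : ∀ n a u → (∀ k → a k * u k ≈ 0#) → dot n a u ≈ 0#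
  dot-zero n a u au≈0 = trans (sum-cong-≋ {n} (λ i → au≈0 (toℕ i))) (sum-replicate-zero n)

  dot-+ʳ : ∀ n a u v w → (∀ k → u k + v k ≈ w k) → dot n a u + dot n a v ≈ dot n a w
  dot-+ʳ n a u v w u+v≈w =
    trans (sym (∑-distrib-+ {n} (λ i → a (toℕ i) * u (toℕ i)) (λ i → a (toℕ i) * v (toℕ i))))
          (sum-cong-≋ {n} (λ i → trans (sym (distribˡ _ _ _)) (*-congˡ (u+v≈w (toℕ i)))))

  dot-*ʳ : ∀ n a x u w → (∀ k → x * u k ≈ w k) → x * dot n a u ≈ dot n a w
  dot-*ʳ n a x u w xu≈w =
    trans (*-distribˡ-sum {n} x (λ i → a (toℕ i) * u (toℕ i)))
          (sum-cong-≋ {n} (λ i →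
            trans (solve 3 (λ x a u → x :* (a :* u) := a :* (x :* u)) refl x (a (toℕ i)) (u (toℕ i)))
                  (*-congˡ (xu≈w (toℕ i)))))

  -- Linearity is proved in the second argument only; this carries it over to the first.
  dot-comm : ∀ n a u → dot n a u ≈ dot n u a
  dot-comm n a u = dot-cong n a u u a (λ k _ → *-comm _ _)

  -- Sums unfold at their first term, while the induction on the harmonic numbers adds a last one.
  sum-snoc : ∀ n (f : ℕ → Carrier) →
             ∑[ i < suc n ] f (toℕ i) ≈ ∑[ i < n ] f (toℕ i) + f n
  sum-snoc zero    f = +-comm _ _
  sum-snoc (suc n) f = trans (+-congˡ (sum-snoc n (λ k → f (suc k)))) (sym (+-assoc _ _ _))

  -- Rising and degenerate falling factorials

  rising : Carrier → ℕ → Carrier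
  rising y zero    = 1#
  rising y (suc k) = rising y k * (y + fromℕ k)

  rising-sucˡ : ∀ y k → rising y (suc k) ≈ y * rising (1# + y) k
  rising-sucˡ y zero    = begin
    1# * (y + 0#)  ≈⟨ *-congˡ (+-identityʳ y) ⟩
    1# * y         ≈⟨ *-comm _ _ ⟩
    y * 1#         ∎
  rising-sucˡ y (suc k) = begin
    rising y (suc k) * (y + (1# + fromℕ k))          ≈⟨ *-congʳ (rising-sucˡ y k) ⟩
    y * rising (1# + y) k * (y + (1# + fromℕ k))
      ≈⟨ solve 4 (λ y r u f → y :* r :* (y :+ (u :+ f)) := y :* (r :* (u :+ y :+ f))) refl _ _ _ _ ⟩
    y * (rising (1# + y) k * (1# + y + fromℕ k))     ∎

  -- The last factor `1# + y + fromℕ k` splits as (k+1) + y, and y completes the remaining product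
  -- to `rising y (suc k)`. This drives both the difference p(y+1) - p(y) = n q(y) and the induction
  -- for the harmonic numbers.
  rising-step : ∀ y k → rising (1# + y) (suc k) ≈ fromℕ (suc k) * rising (1# + y) k + rising y (suc k)
  rising-step y k = begin
    rising (1# + y) k * (1# + y + fromℕ k)
      ≈⟨ solve 4 (λ y r u f → r :* (u :+ y :+ f) := (u :+ f) :* r :+ y :* r) refl _ _ _ _ ⟩
    fromℕ (suc k) * rising (1# + y) k + y * rising (1# + y) k  ≈⟨ +-congˡ (rising-sucˡ y k) ⟨
    fromℕ (suc k) * rising (1# + y) k + rising y (suc k)       ∎

  rising-1 : ∀ k → rising 1# k ≈ fromℕ (k !)
  rising-1 zero    = sym (+-identityʳ 1#)
  rising-1 (suc k) = begin
    rising 1# k * fromℕ (suc k)    ≈⟨ *-congʳ (rising-1 k) ⟩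
    fromℕ (k !) * fromℕ (suc k)    ≈⟨ *-comm _ _ ⟩
    fromℕ (suc k) * fromℕ (k !)    ≈⟨ fromℕ-suc! k ⟨
    fromℕ (suc k !)                ∎

  rising-0 : ∀ k → rising 0# (suc k) ≈ 0#
  rising-0 k = trans (rising-sucˡ 0# k) (zeroˡ _)

  degFalling-cong : ∀ {μ x y} k → x ≈ y → degFalling μ x k ≈ degFalling μ y k
  degFalling-cong zero    x≈y = refl
  degFalling-cong (suc k) x≈y = *-cong (degFalling-cong k x≈y) (+-congʳ x≈y)

  degFalling-0 : ∀ μ k → degFalling μ 0# (suc k) ≈ 0#
  degFalling-0 μ zero    = begin
    1# * (0# - 0# * μ)  ≈⟨ *-identityˡ _ ⟩
    0# - 0# * μ         ≈⟨ +-congˡ (-‿cong (zeroˡ μ)) ⟩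
    0# - 0#             ≈⟨ -‿inverseʳ 0# ⟩
    0#                  ∎
  degFalling-0 μ (suc k) = trans (*-congʳ (degFalling-0 μ k)) (zeroˡ _)

  [x+z]-[z+y]≈x-y : ∀ x y z → (x + z) - (z + y) ≈ x - y
  [x+z]-[z+y]≈x-y x y z = ∙-cancelʳ (z + y) _ _ (begin
    x + z - (z + y) + (z + y)  ≈⟨ //-rightDividesˡ (z + y) (x + z) ⟩
    x + z                      ≈⟨ +-congʳ (//-rightDividesˡ y x) ⟨
    x - y + y + z              ≈⟨ solve 3 (λ d y z → d :+ y :+ z := d :+ (z :+ y)) refl _ _ _ ⟩
    x - y + (z + y)            ∎)

  -- After its first factor, the product for y + μ runs through the factors of the product for y,
  -- since y + μ - (k+1)μ = y - kμ.
  degFalling-sucˡ : ∀ μ y k → degFalling μ (y + μ) (suc k) ≈ (y + μ) * degFalling μ y k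
  degFalling-sucˡ μ y zero    = begin
    1# * (y + μ - 0# * μ)      ≈⟨ *-congˡ (+-congˡ (-‿cong (zeroˡ μ))) ⟩
    1# * (y + μ - 0#)          ≈⟨ *-congˡ (x-0≈x _) ⟩
    1# * (y + μ)               ≈⟨ *-comm _ _ ⟩
    (y + μ) * 1#               ∎
  degFalling-sucˡ μ y (suc k) = begin
    degFalling μ (y + μ) (suc k) * (y + μ - fromℕ (suc k) * μ)
      ≈⟨ *-cong (degFalling-sucˡ μ y k) (begin
           y + μ - (1# + fromℕ k) * μ
             ≈⟨ +-congˡ (-‿cong (trans (distribʳ _ _ _) (+-congʳ (*-identityˡ μ)))) ⟩
           y + μ - (μ + fromℕ k * μ)   ≈⟨ [x+z]-[z+y]≈x-y y (fromℕ k * μ) μ ⟩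
           y - fromℕ k * μ             ∎) ⟩
    (y + μ) * degFalling μ y k * (y - fromℕ k * μ)    ≈⟨ *-assoc _ _ _ ⟩
    (y + μ) * (degFalling μ y k * (y - fromℕ k * μ))  ∎

  -- Signs and the reflection of y to -y

  [-1]*[-1]≈1 : - 1# * - 1# ≈ 1#
  [-1]*[-1]≈1 = trans (-1*x≈-x _) (-‿involutive 1#)

  -- (-1)^k is its own inverse; `k ≤ n` keeps the truncated subtraction exact.
  [-1]^[n∸k] : ∀ {n k} → k ≤ n → (- 1#) ^ n * (- 1#) ^ k ≈ (- 1#) ^ (n ∸ k)
  [-1]^[n∸k] z≤n = *-identityʳ _
  [-1]^[n∸k] {suc n} {suc k} (s≤s k≤n) = begin
    - 1# * (- 1#) ^ n * (- 1# * (- 1#) ^ k)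
      ≈⟨ solve 3 (λ s p q → s :* p :* (s :* q) := s :* s :* (p :* q)) refl _ _ _ ⟩
    - 1# * - 1# * ((- 1#) ^ n * (- 1#) ^ k)  ≈⟨ *-cong [-1]*[-1]≈1 ([-1]^[n∸k] k≤n) ⟩
    1# * (- 1#) ^ (n ∸ k)                    ≈⟨ *-identityˡ _ ⟩
    (- 1#) ^ (n ∸ k)                         ∎

  degFalling-neg : ∀ μ y k → degFalling (- μ) (- y) k ≈ (- 1#) ^ k * degFalling μ y k
  degFalling-neg μ y zero    = sym (*-identityˡ 1#)
  degFalling-neg μ y (suc k) = begin
    degFalling (- μ) (- y) k * (- y - fromℕ k * - μ)
      -- Every negation becomes a factor `- 1#`, which the solver then moves around as a plain
      -- variable.
      ≈⟨ *-cong (degFalling-neg μ y k)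
           (+-cong (sym (-1*x≈-x y)) (trans (sym (-1*x≈-x _)) (*-congˡ (*-congˡ (sym (-1*x≈-x μ)))))) ⟩
    (- 1#) ^ k * degFalling μ y k * (- 1# * y + - 1# * (fromℕ k * (- 1# * μ)))
      ≈⟨ solve 6 (λ p d s y f m → p :* d :* (s :* y :+ s :* (f :* (s :* m)))
                               := s :* p :* (d :* (y :+ s :* (f :* m)))) refl _ _ _ _ _ _ ⟩
    - 1# * (- 1#) ^ k * (degFalling μ y k * (y + - 1# * (fromℕ k * μ)))
      ≈⟨ *-congˡ (*-congˡ (+-congˡ (-1*x≈-x _))) ⟩
    (- 1#) ^ suc k * degFalling μ y (suc k)  ∎

  rising≈falling-neg : ∀ y k → rising y k ≈ (- 1#) ^ k * falling (- y) k
  rising≈falling-neg y zero    = sym (*-identityˡ 1#)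
  rising≈falling-neg y (suc k) = begin
    rising y k * (y + fromℕ k)
      ≈⟨ *-cong (rising≈falling-neg y k) (begin
           y + fromℕ k                       ≈⟨ *-identityˡ _ ⟨
           1# * (y + fromℕ k)                ≈⟨ *-congʳ [-1]*[-1]≈1 ⟨
           - 1# * - 1# * (y + fromℕ k)
             ≈⟨ solve 3 (λ s y f → s :* s :* (y :+ f) := s :* (s :* y :+ s :* f)) refl _ _ _ ⟩
           - 1# * (- 1# * y + - 1# * fromℕ k)  ≈⟨ *-congˡ (+-cong (-1*x≈-x _) (-1*x≈-x _)) ⟩
           - 1# * (- y - fromℕ k)            ∎) ⟩
    (- 1#) ^ k * falling (- y) k * (- 1# * (- y - fromℕ k))
      ≈⟨ solve 4 (λ p f s d → p :* f :* (s :* d) := s :* p :* (f :* d)) refl _ _ _ _ ⟩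
    (- 1#) ^ suc k * falling (- y) (suc k)  ∎

  -- Linear forms in the coefficients of a series

  -- A coefficient vector, of which only the first `N` entries count, witnesses linearity. Forms
  -- composed from `shift` and `⊛` can then be compared without computing their coefficients.
  record LinearForm (N : ℕ) (F : Series → Carrier) : Set (c ⊔ ℓ₁) where
    constructor _,_
    field
      coefficients : Series
      expansion    : ∀ w → F w ≈ dot N coefficients w

  linear-0 : ∀ {N} → LinearForm N (λ _ → 0#)
  linear-0 {N} = (λ _ → 0#) , λ w → sym (dot-zero N (λ _ → 0#) w (λ k → zeroˡ _))

  linear-+ : ∀ {N F G} → LinearForm N F → LinearForm N G → LinearForm N (λ w → F w + G w)
  linear-+ {N} {F} {G} (a , F≈) (b , G≈) = (λ k → a k + b k) , λ w → begin
    F w + G w                ≈⟨ +-cong (trans (F≈ w) (dot-comm N a w)) (trans (G≈ w) (dot-comm N b w)) ⟩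
    dot N w a + dot N w b    ≈⟨ dot-+ʳ N w a b (λ k → a k + b k) (λ k → refl) ⟩
    dot N w (λ k → a k + b k)  ≈⟨ dot-comm N w (λ k → a k + b k) ⟩
    dot N (λ k → a k + b k) w  ∎

  linear-* : ∀ {N F} x → LinearForm N F → LinearForm N (λ w → x * F w)
  linear-* {N} {F} x (a , F≈) = (λ k → x * a k) , λ w → begin
    x * F w                  ≈⟨ *-congˡ (trans (F≈ w) (dot-comm N a w)) ⟩
    x * dot N w a            ≈⟨ dot-*ʳ N w x a (λ k → x * a k) (λ k → refl) ⟩
    dot N w (λ k → x * a k)  ≈⟨ dot-comm N w (λ k → x * a k) ⟩
    dot N (λ k → x * a k) w  ∎

  linear-sum : ∀ {N n} (F : Fin n → Series → Carrier) →
               (∀ i → LinearForm N (F i)) → LinearForm N (λ w → ∑[ i < n ] F i w)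
  linear-sum {n = zero}  F F-lin = linear-0
  linear-sum {n = suc n} F F-lin =
    linear-+ (F-lin fzero) (linear-sum (λ i → F (fsuc i)) (λ i → F-lin (fsuc i)))

  linear-coefficient : ∀ {N k} → k < N → LinearForm N (λ w → w k)
  -- `𝟙` doubles as the first unit vector: beyond its entry 0 it reduces to the constant `0#`.
  linear-coefficient {suc N} {zero}  _         = 𝟙 , λ w → sym (begin
    1# * w 0 + dot N (λ _ → 0#) (λ k → w (suc k))
      ≈⟨ +-cong (*-identityˡ _) (dot-zero N (λ _ → 0#) (λ k → w (suc k)) (λ k → zeroˡ _)) ⟩
    w 0 + 0#      ≈⟨ +-identityʳ _ ⟩
    w 0           ∎)
  linear-coefficient {suc N} {suc k} (s≤s k<N) with linear-coefficient k<N
  ... | a , wk≈ = (λ { zero → 0# ; (suc i) → a i }) , λ w → sym (begin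
    0# * w 0 + dot N a (λ i → w (suc i))  ≈⟨ +-cong (zeroˡ _) (sym (wk≈ (λ i → w (suc i)))) ⟩
    0# + w (suc k)                        ≈⟨ +-identityˡ _ ⟩
    w (suc k)                             ∎)

  linear-dot : ∀ {N} n a (U : Series → Series) → (∀ k → k < n → LinearForm N (λ w → U w k)) →
               LinearForm N (λ w → dot n a (U w))
  linear-dot n a U U-lin =
    linear-sum {n = n} (λ i w → a (toℕ i) * U w (toℕ i)) (λ i → linear-* (a (toℕ i)) (U-lin (toℕ i) (toℕ<n i)))

  -- Coefficient k of the product reads w only at the indices `k ∸ i`, all at most k.
  linear-⊛ : ∀ {N k} (f : Series) → k < N → LinearForm N (λ w → (f ⊛ w) k)
  linear-⊛ {N} {k} f k<N =
    linear-dot (suc k) f (λ w i → w (k ∸ i)) (λ i _ → linear-coefficient (≤-<-trans (m∸n≤m k i) k<N))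

  -- Products of power series

  ⊛-identityʳ : ∀ f → f ⊛ 𝟙 ≋ f
  ⊛-identityʳ f zero    = trans (+-identityʳ _) (*-identityʳ _)
  ⊛-identityʳ f (suc n) =
    trans (+-cong (zeroʳ _) (⊛-identityʳ (λ k → f (suc k)) n)) (+-identityˡ _)

  -- `f` and `f ⊖ 𝟙` differ only in the constant coefficient, where adding back `w n` restores
  -- `f 0`.
  ⊛-⊖-𝟙 : ∀ f w n → ((f ⊖ 𝟙) ⊛ w) n + w n ≈ (f ⊛ w) n
  ⊛-⊖-𝟙 f w n = begin
    (f 0 - 1#) * w n + rest (f ⊖ 𝟙) + w n  ≈⟨ +-congʳ (+-congˡ rest-⊖) ⟩
    (f 0 - 1#) * w n + rest f + w n        ≈⟨ +-congˡ (*-identityˡ _) ⟨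
    (f 0 - 1#) * w n + rest f + 1# * w n
      ≈⟨ solve 4 (λ d w r u → d :* w :+ r :+ u :* w := (d :+ u) :* w :+ r) refl _ _ _ _ ⟩
    (f 0 - 1# + 1#) * w n + rest f         ≈⟨ +-congʳ (*-congʳ (//-rightDividesˡ 1# (f 0))) ⟩
    f 0 * w n + rest f                     ∎
    where
    rest : Series → Carrier
    rest h = dot n (λ k → h (suc k)) (λ k → w (n ∸ suc k))

    rest-⊖ : rest (f ⊖ 𝟙) ≈ rest f
    rest-⊖ = dot-cong n (λ k → (f ⊖ 𝟙) (suc k)) (λ k → w (n ∸ suc k)) (λ k → f (suc k)) (λ k → w (n ∸ suc k))
               (λ k _ → *-congʳ (x-0≈x _))

  𝕥⊛-zero : ∀ w → (𝕥 ⊛ w) 0 ≈ 0#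
  𝕥⊛-zero w = trans (+-identityʳ _) (zeroˡ _)

  𝕥⊛-suc : ∀ w n → (𝕥 ⊛ w) (suc n) ≈ w n
  𝕥⊛-suc w n = begin
    0# * w (suc n) + (1# * w n + dot n (λ _ → 0#) (λ k → w (n ∸ suc k)))
      ≈⟨ +-cong (zeroˡ _) (+-cong (*-identityˡ _) (dot-zero n (λ _ → 0#) (λ k → w (n ∸ suc k)) (λ k → zeroˡ _))) ⟩
    0# + (w n + 0#)  ≈⟨ +-identityˡ _ ⟩
    w n + 0#         ≈⟨ +-identityʳ _ ⟩
    w n              ∎

  -- Multiplication by 1 + μ t

  module _ (μ : Carrier) where

    shift : Series → Series
    shift h zero    = h zero
    shift h (suc n) = h (suc n) + μ * h n

    shift-cong : ∀ {f g} → f ≋ g → shift f ≋ shift g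
    shift-cong f≋g zero    = f≋g zero
    shift-cong f≋g (suc n) = +-cong (f≋g (suc n)) (*-congˡ (f≋g n))

    shift-+ : ∀ f g n → shift f n + shift g n ≈ shift (λ k → f k + g k) n
    shift-+ f g zero    = refl
    shift-+ f g (suc n) = solve 5 (λ a b c d m → a :+ m :* b :+ (c :+ m :* d)
                                              := a :+ c :+ m :* (b :+ d)) refl _ _ _ _ _

    -- Splitting off the constant coefficient of f leaves the same claim for its tail. Index 1 is a
    -- case of its own: there the tail is taken at index 0, where `shift` has no second summand.
    ⊛-shift : ∀ f h → f ⊛ shift h ≋ shift (f ⊛ h)
    ⊛-shift f h zero          = refl
    ⊛-shift f h (suc zero)    = trans
      (solve 6 (λ f₀ f₁ h₀ h₁ m z → f₀ :* (h₁ :+ m :* h₀) :+ (f₁ :* h₀ :+ z)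
                                := f₀ :* h₁ :+ (f₁ :* h₀ :+ z) :+ m :* (f₀ :* h₀)) refl _ _ _ _ _ _)
      (+-congˡ (*-congˡ (sym (+-identityʳ _))))
    ⊛-shift f h (suc (suc n)) = begin
      f 0 * (h (suc (suc n)) + μ * h (suc n)) + (f′ ⊛ shift h) (suc n)
        ≈⟨ +-congˡ (⊛-shift f′ h (suc n)) ⟩
      f 0 * (h (suc (suc n)) + μ * h (suc n)) + ((f′ ⊛ h) (suc n) + μ * (f′ ⊛ h) n)
        ≈⟨ solve 6 (λ f₀ h₂ h₁ m p q → f₀ :* (h₂ :+ m :* h₁) :+ (p :+ m :* q)
                                    := f₀ :* h₂ :+ p :+ m :* (f₀ :* h₁ :+ q)) refl _ _ _ _ _ _ ⟩
      shift (f ⊛ h) (suc (suc n))  ∎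
      where
      f′ : Series
      f′ k = f (suc k)

    shift-𝕥⊛ : ∀ h n → shift (𝕥 ⊛ h) (suc n) ≈ shift h n
    shift-𝕥⊛ h zero    = begin
      (𝕥 ⊛ h) 1 + μ * (𝕥 ⊛ h) 0  ≈⟨ +-cong (𝕥⊛-suc h 0) (*-congˡ (𝕥⊛-zero h)) ⟩
      h 0 + μ * 0#               ≈⟨ +-congˡ (zeroʳ μ) ⟩
      h 0 + 0#                   ≈⟨ +-identityʳ _ ⟩
      h 0                        ∎
    shift-𝕥⊛ h (suc n) = +-cong (𝕥⊛-suc h (suc n)) (*-congˡ (𝕥⊛-suc h n))

    -- Degenerate exponentials under multiplication by 1 + μ t

    degExp-cong : ∀ {x y} → x ≈ y → degExp μ x ≋ degExp μ y
    degExp-cong x≈y k = *-congʳ (degFalling-cong k x≈y)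

    -- Over the common denominator (k+1)!, the coefficient is (y)_{k,μ} times (y - kμ) + (k+1)μ = y
    -- + μ, and `degFalling-sucˡ` absorbs that factor.
    shift-degExp : ∀ y → shift (degExp μ y) ≋ degExp μ (y + μ)
    shift-degExp y zero    = refl
    shift-degExp y (suc k) = begin
      d * z * i + μ * (d * n!#0 k ⁻¹)               ≈⟨ +-congˡ (*-congˡ (*-congˡ (!⁻¹-suc k))) ⟩
      d * z * i + μ * (d * (fromℕ (suc k) * i))
        ≈⟨ solve 6 (λ d z i m u f → d :* z :* i :+ m :* (d :* ((u :+ f) :* i))
                                 := (z :+ f :* m :+ u :* m) :* d :* i) refl _ _ _ _ _ _ ⟩
      (z + fromℕ k * μ + 1# * μ) * d * i
        ≈⟨ *-congʳ (*-congʳ (+-cong (//-rightDividesˡ _ y) (*-identityˡ μ))) ⟩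
      (y + μ) * d * i                               ≈⟨ *-congʳ (degFalling-sucˡ μ y k) ⟨
      degExp μ (y + μ) (suc k)                      ∎
      where
      d = degFalling μ y k
      z = y - fromℕ k * μ
      i = n!#0 (suc k) ⁻¹

    [1+μt]^_ : ℕ → Series
    [1+μt]^ zero  = 𝟙
    [1+μt]^ suc j = shift ([1+μt]^ j)

    fromℕ-suc-* : ∀ j → fromℕ j * μ + μ ≈ fromℕ (suc j) * μ
    fromℕ-suc-* j =
      trans (+-comm _ _) (trans (+-congʳ (sym (*-identityˡ μ))) (sym (distribʳ _ _ _)))

    -- The addition law for exponents is needed only when one of them is jμ; there it follows by
    -- induction from `⊛-shift` and `shift-degExp`, with no appeal to a Vandermonde identity.
    degExp-⊛-[1+μt]^ : ∀ x j → degExp μ x ⊛ [1+μt]^ j ≋ degExp μ (x + fromℕ j * μ)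
    degExp-⊛-[1+μt]^ x zero    n =
      trans (⊛-identityʳ (degExp μ x) n)
            (degExp-cong (trans (sym (+-identityʳ x)) (+-congˡ (sym (zeroˡ μ)))) n)
    degExp-⊛-[1+μt]^ x (suc j) n = begin
      (degExp μ x ⊛ shift ([1+μt]^ j)) n    ≈⟨ ⊛-shift (degExp μ x) ([1+μt]^ j) n ⟩
      shift (degExp μ x ⊛ [1+μt]^ j) n      ≈⟨ shift-cong (degExp-⊛-[1+μt]^ x j) n ⟩
      shift (degExp μ (x + fromℕ j * μ)) n  ≈⟨ shift-degExp _ n ⟩
      degExp μ (x + fromℕ j * μ + μ) n      ≈⟨ degExp-cong (trans (+-assoc _ _ _) (+-congˡ (fromℕ-suc-* j))) n ⟩
      degExp μ (x + fromℕ (suc j) * μ) n    ∎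

    degExp-0 : degExp μ 0# ≋ 𝟙
    degExp-0 zero    = trans (*-comm _ _) (trans (*-congˡ (sym (+-identityʳ 1#))) (⁻¹-inverseˡ (n!#0 0)))
    degExp-0 (suc k) = trans (*-congʳ (degFalling-0 μ k)) (zeroˡ _)

    [1+μt]^≋degExp : ∀ j → [1+μt]^ j ≋ degExp μ (fromℕ j * μ)
    [1+μt]^≋degExp zero    n = sym (trans (degExp-cong (zeroˡ μ) n) (degExp-0 n))
    [1+μt]^≋degExp (suc j) n = begin
      shift ([1+μt]^ j) n              ≈⟨ shift-cong ([1+μt]^≋degExp j) n ⟩
      shift (degExp μ (fromℕ j * μ)) n ≈⟨ shift-degExp _ n ⟩
      degExp μ (fromℕ j * μ + μ) n
        ≈⟨ degExp-cong (fromℕ-suc-* j) n ⟩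
      degExp μ (fromℕ (suc j) * μ) n   ∎

    linear-shift : ∀ {N k} (U : Series → Series) → k < N →
                   (∀ i → i < N → LinearForm N (λ w → U w i)) → LinearForm N (λ w → shift (U w) k)
    linear-shift {k = zero}  U k<N U-lin = U-lin zero k<N
    linear-shift {k = suc k} U k<N U-lin =
      linear-+ (U-lin (suc k) k<N) (linear-* μ (U-lin k (≤-<-trans (m∸n≤m (suc k) 1) k<N)))

    -- Forms determined by the powers of 1 + μ t

    module _ (μ#0 : μ # 0#) where

      -- Since shift h - h = μ t h, a form that vanishes on all powers still does
      -- so after its coefficients are moved down by one.
      vanishes-on-powers⇒vanishes : ∀ N (a : ℕ → Carrier) →
        (∀ j → dot N a ([1+μt]^ j) ≈ 0#) → ∀ w → dot N a w ≈ 0#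
      vanishes-on-powers⇒vanishes zero    a a≈0 w = refl
      vanishes-on-powers⇒vanishes (suc N) a a≈0 w = begin
        a 0 * w 0 + tail (λ k → w (suc k))  ≈⟨ +-cong (*-congʳ a₀≈0) (tail≈0 (λ k → w (suc k))) ⟩
        0# * w 0 + 0#                       ≈⟨ +-identityʳ _ ⟩
        0# * w 0                            ≈⟨ zeroˡ _ ⟩
        0#                                  ∎
        where
        tail : Series → Carrier
        tail = dot N (λ k → a (suc k))

        tail-shift : ∀ h → tail (λ k → shift h (suc k)) ≈ tail (λ k → h (suc k)) + μ * tail h
        tail-shift h = sym (begin
          tail (λ k → h (suc k)) + μ * tail h
            ≈⟨ +-congˡ (dot-*ʳ N (λ k → a (suc k)) μ h (λ k → μ * h k) (λ k → refl)) ⟩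
          tail (λ k → h (suc k)) + tail (λ k → μ * h k)
            ≈⟨ dot-+ʳ N (λ k → a (suc k)) (λ k → h (suc k)) (λ k → μ * h k) _ (λ k → refl) ⟩
          tail (λ k → shift h (suc k))  ∎)

        tail≈0 : ∀ w → tail w ≈ 0#
        tail≈0 = vanishes-on-powers⇒vanishes N (λ k → a (suc k)) (λ j → *-cancelˡ-# μ#0 (begin
          μ * tail ([1+μt]^ j)       ≈⟨ +-identityˡ _ ⟨
          0# + μ * tail ([1+μt]^ j)  ≈⟨ +-congʳ (a≈0 j) ⟨
          a 0 * ([1+μt]^ j) 0 + tail (λ k → ([1+μt]^ j) (suc k)) + μ * tail ([1+μt]^ j)
                                     ≈⟨ +-assoc _ _ _ ⟩
          a 0 * ([1+μt]^ j) 0 + (tail (λ k → ([1+μt]^ j) (suc k)) + μ * tail ([1+μt]^ j))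
                                     ≈⟨ +-congˡ (tail-shift ([1+μt]^ j)) ⟨
          -- The powers j and j + 1 share their constant coefficient by definition of `shift`, so
          -- this is the form at the power j + 1.
          a 0 * ([1+μt]^ j) 0 + tail (λ k → shift ([1+μt]^ j) (suc k))
                                     ≈⟨ a≈0 (suc j) ⟩
          0#                         ≈⟨ zeroʳ μ ⟨
          μ * 0#                     ∎))

        a₀≈0 : a 0 ≈ 0#
        a₀≈0 = begin
          a 0                              ≈⟨ *-identityʳ _ ⟨
          a 0 * 1#                         ≈⟨ +-identityʳ _ ⟨
          a 0 * 1# + 0#                    ≈⟨ +-congˡ (tail≈0 (λ k → 𝟙 (suc k))) ⟨
          a 0 * 1# + tail (λ k → 𝟙 (suc k))  ≈⟨ a≈0 0 ⟩
          0#                               ∎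

      -- The form F - G, written with the scalar -1, vanishes on all powers and therefore
      -- everywhere.
      agree-on-powers⇒agree : ∀ {N F G} → LinearForm N F → LinearForm N G →
        (∀ j → F ([1+μt]^ j) ≈ G ([1+μt]^ j)) → ∀ w → F w ≈ G w
      agree-on-powers⇒agree {N} {F} {G} F-lin G-lin F≈G w with linear-+ F-lin (linear-* (- 1#) G-lin)
      ... | a , F-G≈ = ∙-cancelʳ (- 1# * G w) _ _ (begin
        F w + - 1# * G w  ≈⟨ F-G≈ w ⟩
        dot N a w         ≈⟨ vanishes-on-powers⇒vanishes N a (λ j → trans (sym (F-G≈ ([1+μt]^ j))) (diff≈0 (F≈G j))) w ⟩
        0#                ≈⟨ diff≈0 refl ⟨
        G w + - 1# * G w  ∎)
        where
        diff≈0 : ∀ {x y} → x ≈ y → x + - 1# * y ≈ 0#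
        diff≈0 {x} {y} x≈y = trans (+-cong x≈y (-1*x≈-x y)) (-‿inverseʳ y)

      -- Degenerate harmonic numbers and rising factorials

      n!*degHarmonic : ∀ n → fromℕ (n !) * (μ * degHarmonic (-x#0 μ#0) n) + fromℕ (n !) ≈ rising (1# + μ) n
      n!*degHarmonic zero    = begin
        fromℕ 1 * (μ * 0#) + fromℕ 1  ≈⟨ +-cong (trans (*-congˡ (zeroʳ μ)) (zeroʳ _)) (+-identityʳ 1#) ⟩
        0# + 1#                       ≈⟨ +-identityˡ 1# ⟩
        1#                            ∎
      n!*degHarmonic (suc n) = begin
        fromℕ (suc n !) * (μ * degHarmonic (-x#0 μ#0) (suc n)) + fromℕ (suc n !)
          ≈⟨ +-congʳ (*-congˡ (*-congˡ (sum-snoc n (λ k → term (suc k))))) ⟩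
        fromℕ (suc n !) * (μ * (H + term (suc n))) + fromℕ (suc n !)
          ≈⟨ solve 4 (λ F m H T → F :* (m :* (H :+ T)) :+ F := F :* (m :* H :+ m :* T) :+ F) refl _ _ _ _ ⟩
        fromℕ (suc n !) * (μ * H + μ * term (suc n)) + fromℕ (suc n !)
          ≈⟨ +-congʳ (distribˡ _ _ _) ⟩
        fromℕ (suc n !) * (μ * H) + fromℕ (suc n !) * (μ * term (suc n)) + fromℕ (suc n !)
          ≈⟨ +-cong (+-cong (*-congʳ (fromℕ-suc! n)) last-term) (fromℕ-suc! n) ⟩
        fromℕ (suc n) * fromℕ (n !) * (μ * H) + rising μ (suc n) + fromℕ (suc n) * fromℕ (n !)
          ≈⟨ solve 4 (λ s f h r → s :* f :* h :+ r :+ s :* f := s :* (f :* h :+ f) :+ r) refl _ _ _ _ ⟩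
        fromℕ (suc n) * (fromℕ (n !) * (μ * H) + fromℕ (n !)) + rising μ (suc n)
          -- n + 1 times the induction hypothesis, plus the new term, is the recursion `rising-step`
          -- at y = μ.
          ≈⟨ +-congʳ (*-congˡ (n!*degHarmonic n)) ⟩
        fromℕ (suc n) * rising (1# + μ) n + rising μ (suc n)
          ≈⟨ rising-step μ n ⟨
        rising (1# + μ) (suc n)  ∎
        where
        H = degHarmonic (-x#0 μ#0) n
        v = (-x#0 μ#0) ⁻¹

        term : ℕ → Carrier
        term k = v * binomial (- μ) k * (- 1#) ^ (k ∸ 1)

        μ*v≈-1 : μ * v ≈ - 1#
        μ*v≈-1 = begin
          μ * v                ≈⟨ *-identityˡ _ ⟨
          1# * (μ * v)         ≈⟨ *-congʳ [-1]*[-1]≈1 ⟨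
          - 1# * - 1# * (μ * v)  ≈⟨ solve 3 (λ s m v → s :* s :* (m :* v) := s :* (v :* (s :* m))) refl _ _ _ ⟩
          - 1# * (v * (- 1# * μ))  ≈⟨ *-congˡ (*-congˡ (-1*x≈-x μ)) ⟩
          - 1# * (v * - μ)     ≈⟨ *-congˡ (⁻¹-inverseˡ (-x#0 μ#0)) ⟩
          - 1# * 1#            ≈⟨ *-identityʳ _ ⟩
          - 1#                 ∎

        -- The factorial cancels the denominator of the binomial, and μ times the inverse of -μ
        -- raises (-1)^n to (-1)^(n+1), the sign that turns the falling factorial of -μ into a
        -- rising one.
        last-term : fromℕ (suc n !) * (μ * term (suc n)) ≈ rising μ (suc n)
        last-term = begin
          fromℕ (suc n !) * (μ * (v * (falling (- μ) (suc n) * n!#0 (suc n) ⁻¹) * (- 1#) ^ n))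
            ≈⟨ solve 6 (λ F m v f i p → F :* (m :* (v :* (f :* i) :* p))
                                     := F :* (f :* i) :* (m :* v :* p)) refl _ _ _ _ _ _ ⟩
          fromℕ (suc n !) * egf (falling (- μ)) (suc n) * (μ * v * (- 1#) ^ n)
            ≈⟨ *-cong (!*egf (falling (- μ)) (suc n)) (*-congʳ μ*v≈-1) ⟩
          falling (- μ) (suc n) * (- 1#) ^ suc n  ≈⟨ *-comm _ _ ⟩
          (- 1#) ^ suc n * falling (- μ) (suc n)  ≈⟨ rising≈falling-neg μ (suc n) ⟨
          rising μ (suc n)                        ∎

      -- The functional Λ on rising factorials

      module _ (m : ℕ) (a : ℕ → Carrier)
               (a-rising : ∀ y → rising y (suc m) ≈ dot (suc (suc m)) a (degFalling μ y)) where

        private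
          -- The factor k! offsets the 1/k! in `degExp`, so `â` pairs with an exponential generating
          -- function as `a` does with its underlying sequence.
          â : ℕ → Carrier
          â k = a k * fromℕ (k !)

          evaluate : ∀ y → dot (suc (suc m)) â (degExp μ y) ≈ rising y (suc m)
          evaluate y = sym (trans (a-rising y) (dot-cong (suc (suc m)) a (degFalling μ y) â (degExp μ y)
            (λ k _ → trans (*-congˡ (sym (!*egf (degFalling μ y) k))) (sym (*-assoc _ _ _)))))

          -- On e_μ^y(t) this is the forward difference in y. The `shift` around it in `difference`
          -- translates y by μ, as in the definition of p.
          Δ : Series → Series
          Δ w = (degExp μ 1# ⊖ 𝟙) ⊛ w

          -- With wₖ = Λ (y)_{k,μ} / k!, these are Λ (p(y+1) - p(y)) and Λ (n q).
          difference multiple : Series → Carrier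
          difference w = dot (suc (suc m)) â (shift (Δ w))
          multiple   w = fromℕ (suc m) * dot (suc m) (λ k → a (suc k)) (λ k → fromℕ (k !) * w k)

          difference-linear : LinearForm (suc (suc m)) difference
          difference-linear = linear-dot (suc (suc m)) â (λ w → shift (Δ w)) (λ k k<N →
            linear-shift Δ k<N (λ i → linear-⊛ (degExp μ 1# ⊖ 𝟙)))

          multiple-linear : LinearForm (suc (suc m)) multiple
          multiple-linear = linear-* (fromℕ (suc m))
            (linear-dot (suc m) (λ k → a (suc k)) (λ w k → fromℕ (k !) * w k)
              (λ k k<N → linear-* (fromℕ (k !)) (linear-coefficient (m<n⇒m<1+n k<N))))

          -- At y = 0 every other term of the expansion vanishes, and so does the rising factorial.
          -- This is what allows the division by y.
          a₀≈0 : a 0 ≈ 0#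
          a₀≈0 = begin
            a 0            ≈⟨ *-identityʳ _ ⟨
            a 0 * 1#       ≈⟨ +-identityʳ _ ⟨
            a 0 * 1# + 0#
              ≈⟨ +-congˡ (dot-zero (suc m) (λ k → a (suc k)) (λ k → degFalling μ 0# (suc k))
                   (λ k → trans (*-congˡ (degFalling-0 μ k)) (zeroʳ _))) ⟨
            dot (suc (suc m)) a (degFalling μ 0#)  ≈⟨ a-rising 0# ⟨
            rising 0# (suc m)                      ≈⟨ rising-0 m ⟩
            0#                                     ∎

          -- Pairing with (1+μt)^j is evaluation at jμ, and the translation in p moves that point to
          -- y = (j+1)μ.
          difference-on-powers : ∀ j → let y = fromℕ (suc j) * μ in
            difference ([1+μt]^ j) + rising y (suc m) ≈ rising (1# + y) (suc m)
          difference-on-powers j = begin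
            difference P + rising y (suc m)                           ≈⟨ +-congˡ (evaluate y) ⟨
            difference P + dot (suc (suc m)) â (degExp μ y)
              ≈⟨ dot-+ʳ (suc (suc m)) â (shift (Δ P)) (degExp μ y) (degExp μ (1# + y)) step ⟩
            dot (suc (suc m)) â (degExp μ (1# + y))                   ≈⟨ evaluate (1# + y) ⟩
            rising (1# + y) (suc m)                                   ∎
            where
            P = [1+μt]^ j
            y = fromℕ (suc j) * μ

            step : ∀ k → shift (Δ P) k + degExp μ y k ≈ degExp μ (1# + y) k
            step k = begin
              -- `shift P` is `[1+μt]^ suc j` by definition, which is the exponential with exponent
              -- y.
              shift (Δ P) k + degExp μ y k     ≈⟨ +-congˡ ([1+μt]^≋degExp (suc j) k) ⟨
              shift (Δ P) k + shift P k        ≈⟨ shift-+ (Δ P) P k ⟩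
              shift (λ k → Δ P k + P k) k      ≈⟨ shift-cong (⊛-⊖-𝟙 (degExp μ 1#) P) k ⟩
              shift (degExp μ 1# ⊛ P) k        ≈⟨ ⊛-shift (degExp μ 1#) P k ⟨
              (degExp μ 1# ⊛ [1+μt]^ suc j) k  ≈⟨ degExp-⊛-[1+μt]^ 1# (suc j) k ⟩
              degExp μ (1# + y) k              ∎

          -- As y = (j+1)μ is apart from 0 even for j = 0, both sides may be multiplied by y. Then
          -- `a₀≈0` completes the left one to the full expansion of `rising y (suc m)`.
          multiple-on-powers : ∀ j →
            multiple ([1+μt]^ j) ≈ fromℕ (suc m) * rising (1# + fromℕ (suc j) * μ) m
          multiple-on-powers j = *-congˡ (*-cancelˡ-# μ#0 (*-cancelˡ-# (fromℕ#0 (suc j)) (begin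
            fromℕ (suc j) * (μ * dot (suc m) a′ v)      ≈⟨ *-assoc _ _ _ ⟨
            y * dot (suc m) a′ v
              ≈⟨ dot-*ʳ (suc m) a′ y v (λ k → degFalling μ y (suc k)) step ⟩
            dot (suc m) a′ (λ k → degFalling μ y (suc k))  ≈⟨ +-identityˡ _ ⟨
            0# + dot (suc m) a′ (λ k → degFalling μ y (suc k))
              ≈⟨ +-congʳ (trans (*-identityʳ _) a₀≈0) ⟨
            dot (suc (suc m)) a (degFalling μ y)        ≈⟨ a-rising y ⟨
            rising y (suc m)                            ≈⟨ rising-sucˡ y m ⟩
            y * rising (1# + y) m                       ≈⟨ *-assoc _ _ _ ⟩
            fromℕ (suc j) * (μ * rising (1# + y) m)     ∎)))
            where
            y = fromℕ (suc j) * μ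

            a′ v : Series
            a′ k = a (suc k)
            v  k = fromℕ (k !) * ([1+μt]^ j) k

            step : ∀ k → y * v k ≈ degFalling μ y (suc k)
            step k = begin
              y * (fromℕ (k !) * ([1+μt]^ j) k)
                ≈⟨ *-congˡ (trans (*-congˡ ([1+μt]^≋degExp j k)) (!*egf (degFalling μ (fromℕ j * μ)) k)) ⟩
              y * degFalling μ (fromℕ j * μ) k                  ≈⟨ *-congʳ (fromℕ-suc-* j) ⟨
              (fromℕ j * μ + μ) * degFalling μ (fromℕ j * μ) k  ≈⟨ degFalling-sucˡ μ (fromℕ j * μ) k ⟨
              degFalling μ (fromℕ j * μ + μ) (suc k)            ≈⟨ degFalling-cong (suc k) (fromℕ-suc-* j) ⟩
              degFalling μ y (suc k)                            ∎

          -- On powers this is `rising-step` at y = (j+1)μ, and the powers determine both forms.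
          difference≈multiple : ∀ w → difference w ≈ multiple w
          difference≈multiple = agree-on-powers⇒agree difference-linear multiple-linear (λ j →
            ∙-cancelʳ (rising (fromℕ (suc j) * μ) (suc m)) _ _ (begin
              difference ([1+μt]^ j) + rising (fromℕ (suc j) * μ) (suc m)  ≈⟨ difference-on-powers j ⟩
              rising (1# + fromℕ (suc j) * μ) (suc m)                      ≈⟨ rising-step _ m ⟩
              fromℕ (suc m) * rising (1# + fromℕ (suc j) * μ) m + rising (fromℕ (suc j) * μ) (suc m)
                ≈⟨ +-congʳ (multiple-on-powers j) ⟨
              multiple ([1+μt]^ j) + rising (fromℕ (suc j) * μ) (suc m)     ∎))

        -- The hypothesis turns `Δ w` into t e_μ^{1-μ}(t). The `shift` in `difference` raises the
        -- exponent from 1 - μ to 1, and μ t e_μ + e_μ = (1 + μ t) e_μ = e_μ^{1+μ}, so that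
        -- `evaluate` yields the rising factorials at 1 and 1 + μ.
        bernoulli-sum : ∀ w → (degExp μ 1# ⊖ 𝟙) ⊛ w ≋ 𝕥 ⊛ degExp μ (1# - μ) →
          μ * (fromℕ (suc m) * dot (suc m) (λ k → a (suc k)) (λ k → fromℕ (k !) * w k)) + rising 1# (suc m)
            ≈ rising (1# + μ) (suc m)
        bernoulli-sum w w-bernoulli = begin
          μ * multiple w + rising 1# (suc m)
            ≈⟨ +-cong (*-congˡ (difference≈multiple w)) (evaluate 1#) ⟨
          μ * difference w + dot (suc (suc m)) â (degExp μ 1#)
            ≈⟨ +-congʳ (dot-*ʳ (suc (suc m)) â μ (shift (Δ w)) (λ k → μ * shift (𝕥 ⊛ degExp μ (1# - μ)) k)
                 (λ k → *-congˡ (shift-cong w-bernoulli k))) ⟩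
          dot (suc (suc m)) â (λ k → μ * shift (𝕥 ⊛ degExp μ (1# - μ)) k) + dot (suc (suc m)) â (degExp μ 1#)
            ≈⟨ dot-+ʳ (suc (suc m)) â _ (degExp μ 1#) (degExp μ (1# + μ)) step ⟩
          dot (suc (suc m)) â (degExp μ (1# + μ))  ≈⟨ evaluate (1# + μ) ⟩
          rising (1# + μ) (suc m)                  ∎
          where
          step : ∀ k → μ * shift (𝕥 ⊛ degExp μ (1# - μ)) k + degExp μ 1# k ≈ degExp μ (1# + μ) k
          step zero    = trans (+-congʳ (trans (*-congˡ (𝕥⊛-zero (degExp μ (1# - μ)))) (zeroʳ μ))) (+-identityˡ _)
          step (suc k) = begin
            μ * shift (𝕥 ⊛ degExp μ (1# - μ)) (suc k) + degExp μ 1# (suc k)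
              ≈⟨ +-congʳ (*-congˡ (shift-𝕥⊛ (degExp μ (1# - μ)) k)) ⟩
            μ * shift (degExp μ (1# - μ)) k + degExp μ 1# (suc k)
              ≈⟨ +-congʳ (*-congˡ (trans (shift-degExp (1# - μ) k) (degExp-cong (//-rightDividesˡ μ 1#) k))) ⟩
            μ * degExp μ 1# k + degExp μ 1# (suc k)  ≈⟨ +-comm _ _ ⟩
            shift (degExp μ 1#) (suc k)              ≈⟨ shift-degExp 1# (suc k) ⟩
            degExp μ (1# + μ) (suc k)                ∎

  -- Stirling coefficients and conclusion

  stirling⇒rising : ∀ μ (S₁ : ℕ → ℕ → Carrier) → IsDegenerateStirling₁ (- μ) S₁ → ∀ n y →
    rising y n ≈ dot (suc n) (λ k → (- 1#) ^ n * (- 1#) ^ k * S₁ n k) (degFalling μ y)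
  stirling⇒rising μ S₁ S₁-stirling n y = begin
    rising y n                     ≈⟨ rising≈falling-neg y n ⟩
    (- 1#) ^ n * falling (- y) n   ≈⟨ *-congˡ (S₁-stirling n (- y)) ⟩
    (- 1#) ^ n * dot (suc n) (S₁ n) (degFalling (- μ) (- y))
      ≈⟨ dot-*ʳ (suc n) (S₁ n) ((- 1#) ^ n) (degFalling (- μ) (- y))
           (λ k → (- 1#) ^ n * ((- 1#) ^ k * degFalling μ y k)) (λ k → *-congˡ (degFalling-neg μ y k)) ⟩
    dot (suc n) (S₁ n) (λ k → (- 1#) ^ n * ((- 1#) ^ k * degFalling μ y k))
      -- The sign stays a product of two powers, valid for every k; `[-1]^[n∸k]` merges them later,
      -- where the bound on k is used.
      ≈⟨ dot-cong (suc n) (S₁ n) _ (λ k → (- 1#) ^ n * (- 1#) ^ k * S₁ n k) (degFalling μ y) (λ k _ →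
           solve 4 (λ p s q d → s :* (p :* (q :* d)) := p :* q :* s :* d)
             refl ((- 1#) ^ n) (S₁ n k) ((- 1#) ^ k) (degFalling μ y k)) ⟩
    dot (suc n) (λ k → (- 1#) ^ n * (- 1#) ^ k * S₁ n k) (degFalling μ y)  ∎

theorem8 : ∀ {c ℓ₁ ℓ₂} (ℝ : RealField c ℓ₁ ℓ₂) →
    let open Degenerate ℝ in
    (λ′ : Carrier) (λ′#0 : λ′ # 0#) →
    (β : ℕ → Carrier → Carrier) → IsDegenerateBernoulli λ′ β →
    (S₁ : ℕ → ℕ → Carrier) → IsDegenerateStirling₁ (- λ′) S₁ →
    (n : ℕ) .{{_ : NonZero n}} →
    fromℕ ((n ∸ 1) !) * degHarmonic (-x#0 λ′#0) n
    ≈ ∑[ k ∈1⋯ n ] ((- 1#) ^ (n ∸ k) * β (k ∸ 1) (1# - λ′) * S₁ n k)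
theorem8 ℝ λ′ λ′#0 β β-bernoulli S₁ S₁-stirling (suc m) =
  -- Multiplied by nλ and with n! added, both sides become (1+λ) ⋯ (n+λ).
  trans (*-cancelˡ-# ℝ (fromℕ#0 (suc m)) (*-cancelˡ-# ℝ λ′#0 (∙-cancelʳ (fromℕ (suc m !)) _ _ (begin
    λ′ * (fromℕ (suc m) * (fromℕ (m !) * H)) + fromℕ (suc m !)
      ≈⟨ +-congʳ (solve 4 (λ l s f h → l :* (s :* (f :* h)) := s :* f :* (l :* h)) refl _ _ _ _) ⟩
    fromℕ (suc m) * fromℕ (m !) * (λ′ * H) + fromℕ (suc m !)
      ≈⟨ +-congʳ (*-congʳ (fromℕ-suc! ℝ m)) ⟨
    fromℕ (suc m !) * (λ′ * H) + fromℕ (suc m !)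
      ≈⟨ n!*degHarmonic ℝ λ′ λ′#0 (suc m) ⟩
    rising ℝ (1# + λ′) (suc m)
      ≈⟨ bernoulli-sum ℝ λ′ λ′#0 m a (stirling⇒rising ℝ λ′ S₁ S₁-stirling (suc m)) w (β-bernoulli (1# - λ′)) ⟨
    λ′ * (fromℕ (suc m) * Σβ) + rising ℝ 1# (suc m)
      ≈⟨ +-congˡ (rising-1 ℝ (suc m)) ⟩
    λ′ * (fromℕ (suc m) * Σβ) + fromℕ (suc m !)  ∎))))
  (sum-cong-≋ {suc m} (λ i → summand (toℕ i) (toℕ<n i)))
  where
  open Degenerate ℝ hiding (_<_; zero)
  open CommutativeRing commutativeRing using (commutativeSemiring; +-commutativeMonoid; +-group)
  open CommutativeMonoidSum +-commutativeMonoid using (sum-cong-≋)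
  open GroupProperties +-group using (∙-cancelʳ)
  open SemiringSolver commutativeSemiring using (solve; _:*_; _:=_)
  open SetoidReasoning setoid

  H : Carrier
  H = degHarmonic (-x#0 λ′#0) (suc m)

  a w : ℕ → Carrier
  a k = (- 1#) ^ suc m * (- 1#) ^ k * S₁ (suc m) k
  w   = egf (λ k → β k (1# - λ′))

  Σβ : Carrier
  Σβ = dot ℝ (suc m) (λ k → a (suc k)) (λ k → fromℕ (k !) * w k)

  summand : ∀ k → k < suc m → a (suc k) * (fromℕ (k !) * w k)
            ≈ (- 1#) ^ (m ∸ k) * β k (1# - λ′) * S₁ (suc m) (suc k)
  summand k k<n = begin
    a (suc k) * (fromℕ (k !) * w k)
      ≈⟨ *-congˡ (!*egf ℝ (λ k → β k (1# - λ′)) k) ⟩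
    a (suc k) * β k (1# - λ′)
      -- `k<n` unfolds to `suc k ≤ suc m`, and the exponent `suc m ∸ suc k` computes to `m ∸ k`.
      ≈⟨ *-congʳ (*-congʳ ([-1]^[n∸k] ℝ k<n)) ⟩
    (- 1#) ^ (m ∸ k) * S₁ (suc m) (suc k) * β k (1# - λ′)
      ≈⟨ solve 3 (λ p s b → p :* s :* b := p :* b :* s) refl _ _ _ ⟩
    (- 1#) ^ (m ∸ k) * β k (1# - λ′) * S₁ (suc m) (suc k)  ∎
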